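{- Let $\mathcal{S}$ be a nonempty set and let $X$ and $Y$ be lenses with source $\mathcal{S}$ and views $V_1$ and $V_2$ respectively. Then $X\approx Y$ (lens equivalence) if and only if $X^\sim=Y^\sim$.
   Context: A lens $X$ with view $V$ and source $\mathcal{S}$ consists of functions $\mathrm{get}_X:\mathcal{S}\to V$ and $\mathrm{put}_X:V\to\mathcal{S}\to\mathcal{S}$ satisfying, for all $s\in\mathcal{S}$ and $v,v'\in V$: $\mathrm{get}_X(\mathrm{put}_X\,v\,s)=v$, $\mathrm{put}_X\,v\,(\mathrm{put}_X\,v'\,s)=\mathrm{put}_X\,v\,s$, and $\mathrm{put}_X\,(\mathrm{get}_X\,s)\,s=s$. Composition: if $Z$ is a lens with view $V_1$ and source $V_2$, and $Y$ is a lens with view $V_2$ and source $\mathcal{S}$, then $Z\mathbin{;}Y$ is the lens with view $V_1$ and source $\mathcal{S}$ given by $\mathrm{get}\,s=\mathrm{get}_Z(\mathrm{get}_Y\,s)$ and $\mathrm{put}\,v\,s=\mathrm{put}_Y\,(\mathrm{put}_Z\,v\,(\mathrm{get}_Y\,s))\,s$. Sublens: for lenses $X$ (view $V_1$) and $Y$ (view $V_2$) with source $\mathcal{S}$, $X\preceq Y$ iff there is a lens $Z$ with view $V_1$ and source $V_2$ such that $X=Z\mathbin{;}Y$. Lens equivalence: $X\approx Y$ iff $X\preceq Y$ and $Y\preceq X$. The scene of a lens $X$ is the function $X^\sim:\mathcal{S}\to\mathcal{S}\to\mathcal{S}$, $X^\sim=(\lambda s_1\,s_2.\ \mathrm{put}_X\,(\mathrm{get}_X\,s_2)\,s_1)$;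 equality of scenes is equality of these functions. -}

module Defs where

open import Level using (Level; _⊔_)
open import Data.Product using (_×_; ∃-syntax)
open import Relation.Binary.PropositionalEquality using (_≡_; _≗_; trans; cong; module ≡-Reasoning)

private
  variable
    a b c : Level
    V V₁ V₂ S : Set a

record Lens (V : Set a) (S : Set b) : Set (a ⊔ b) where
  field
    get     : S → V
    put     : V → S → S
    get-put : ∀ s v → get (put v s) ≡ v
    put-put : ∀ s v v′ → put v (put v′ s) ≡ put v s
    put-get : ∀ s → put (get s) s ≡ s

open Lens public

-- A lens is a pair of functions subject to laws, so two lenses are equal when
-- their functions are. Functions are compared pointwise throughout, since
-- function extensionality is not available for _≡_.
infix 4 _≐_ _≼_ _≈_ _≐ₛ_

_≐_ : Lens V S → Lens V S → Set _
X ≐ Y = (get X ≗ get Y) × (∀ v → put X v ≗ put Y v)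

infixr 9 _⨾_

_⨾_ : Lens V₁ V₂ → Lens V₂ S → Lens V₁ S
Z ⨾ Y = record
  { get     = λ s → get Z (get Y s)
  ; put     = λ v s → put Y (put Z v (get Y s)) s
  ; get-put = λ s v → trans (cong (get Z) (get-put Y s _)) (get-put Z (get Y s) v)
  ; put-put = λ s v v′ → begin
      put Y (put Z v (get Y (put Y (put Z v′ (get Y s)) s))) (put Y (put Z v′ (get Y s)) s)
        ≡⟨ put-put Y s _ _ ⟩
      put Y (put Z v (get Y (put Y (put Z v′ (get Y s)) s))) s
        ≡⟨ cong (λ u → put Y (put Z v u) s) (get-put Y s _) ⟩
      put Y (put Z v (put Z v′ (get Y s))) s
        ≡⟨ cong (λ u → put Y u s) (put-put Z (get Y s) v v′) ⟩
      put Y (put Z v (get Y s)) s ∎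
  ; put-get = λ s → trans (cong (λ u → put Y u s) (put-get Z (get Y s))) (put-get Y s)
  }
  where open ≡-Reasoning

_≼_ : {V₁ : Set a} {V₂ : Set b} {S : Set c} → Lens V₁ S → Lens V₂ S → Set (a ⊔ b ⊔ c)
X ≼ Y = ∃[ Z ] X ≐ (Z ⨾ Y)

_≈_ : {V₁ : Set a} {V₂ : Set b} {S : Set c} → Lens V₁ S → Lens V₂ S → Set (a ⊔ b ⊔ c)
X ≈ Y = (X ≼ Y) × (Y ≼ X)

infix 10 _˜

_˜ : Lens V S → S → S → S
(X ˜) s₁ s₂ = put X (get X s₂) s₁

_≐ₛ_ : {S : Set a} → (S → S → S) → (S → S → S) → Set a
f ≐ₛ g = ∀ s₁ → f s₁ ≗ g s₁

{-# OPTIONS --safe #-}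
-- If X ≼ Y, then restoring the X-part before restoring the Y-part changes
-- nothing, and restoring it afterwards changes nothing either. So X ≈ Y forces
-- both scenes to equal Y˜ (X˜ s₁ s₂) s₂. Conversely, equal scenes identify the
-- two views by transporting through put into a fixed source s.
module Submission where

open import Level using (Level)
open import Data.Product using (_,_)
open import Function.Bundles using (_⇔_; mk⇔)
open import Relation.Binary.PropositionalEquality
  using (_≡_; refl; sym; trans; cong; module ≡-Reasoning)
open import Defs

open ≡-Reasoning

private
  variable
    a b c : Level
    V V₁ V₂ S : Set a

get-˜ : (X : Lens V S) → ∀ s₁ s₂ → get X ((X ˜) s₁ s₂) ≡ get X s₂
get-˜ X s₁ s₂ = get-put X s₁ (get X s₂)

˜-put : (X : Lens V S) → ∀ s₁ s₂ v → (X ˜) s₁ (put X v s₂) ≡ put X v s₁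
˜-put X s₁ s₂ v = cong (λ u → put X u s₁) (get-put X s₂ v)

-- By `put≗` the inner `put X` is itself a `put Y` of some view, so the outer `put Y` overwrites it.
≼⇒˜-absorbs-before : (X : Lens V₁ S) (Y : Lens V₂ S) → X ≼ Y →
  ∀ s₁ s₂ → (Y ˜) ((X ˜) s₁ s₂) s₂ ≡ (Y ˜) s₁ s₂
≼⇒˜-absorbs-before X Y (Z , _ , put≗) s₁ s₂ = trans
  (cong (put Y (get Y s₂)) (put≗ (get X s₂) s₁))
  (put-put Y s₁ _ _)

-- `get X` factors through `get Y`: once the Y-view of `s₂` is in place, the X-view agrees with that
-- of `s₂` too, and writing it again is a no-op.
≼⇒˜-absorbs-after : (X : Lens V₁ S) (Y : Lens V₂ S) → X ≼ Y →
  ∀ s₁ s₂ → (X ˜) ((Y ˜) s₁ s₂) s₂ ≡ (Y ˜) s₁ s₂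
≼⇒˜-absorbs-after X Y (Z , get≗ , _) s₁ s₂ = begin
  put X (get X s₂) t  ≡⟨ cong (λ v → put X v t) get-t ⟨
  put X (get X t) t   ≡⟨ put-get X t ⟩
  t                   ∎
  where
  t = (Y ˜) s₁ s₂

  get-t : get X t ≡ get X s₂
  get-t = begin
    get X t            ≡⟨ get≗ t ⟩
    get Z (get Y t)    ≡⟨ cong (get Z) (get-˜ Y s₁ s₂) ⟩
    get Z (get Y s₂)   ≡⟨ get≗ s₂ ⟨
    get X s₂           ∎

≈⇒≐ₛ : (X : Lens V₁ S) (Y : Lens V₂ S) → X ≈ Y → X ˜ ≐ₛ Y ˜
≈⇒≐ₛ X Y (X≼Y , Y≼X) s₁ s₂ = begin
  (X ˜) s₁ s₂               ≡⟨ ≼⇒˜-absorbs-after Y X Y≼X s₁ s₂ ⟨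
  (Y ˜) ((X ˜) s₁ s₂) s₂    ≡⟨ ≼⇒˜-absorbs-before X Y X≼Y s₁ s₂ ⟩
  (Y ˜) s₁ s₂               ∎

≐ₛ⇒≼ : S → (X : Lens V₁ S) (Y : Lens V₂ S) → X ˜ ≐ₛ Y ˜ → X ≼ Y
≐ₛ⇒≼ {V₁ = V₁} {V₂ = V₂} s X Y X˜≐Y˜ = Z , get≗ , put≗
  where
  Z : Lens V₁ V₂
  Z = record
    { get     = λ u → get X (put Y u s)
    -- The old view can be discarded: `Z` is a bijection between the views, and this is the inverse
    -- of its `get`.
    ; put     = λ v _ → get Y (put X v s)
    ; get-put = λ _ v → begin
        -- The round trip through `V₂` unfolds to a Y-scene on `s`, which the hypothesis trades for
        -- an X-scene.
        get X ((Y ˜) s (put X v s))  ≡⟨ cong (get X) (X˜≐Y˜ s (put X v s)) ⟨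
        get X ((X ˜) s (put X v s))  ≡⟨ get-˜ X s (put X v s) ⟩
        get X (put X v s)            ≡⟨ get-put X s v ⟩
        v                            ∎
    ; put-put = λ _ _ _ → refl
    ; put-get = λ u → begin
        get Y ((X ˜) s (put Y u s))  ≡⟨ cong (get Y) (X˜≐Y˜ s (put Y u s)) ⟩
        get Y ((Y ˜) s (put Y u s))  ≡⟨ get-˜ Y s (put Y u s) ⟩
        get Y (put Y u s)            ≡⟨ get-put Y s u ⟩
        u                            ∎
    }

  get≗ : ∀ t → get X t ≡ get X ((Y ˜) s t)
  get≗ t = begin
    get X t              ≡⟨ get-˜ X s t ⟨
    get X ((X ˜) s t)    ≡⟨ cong (get X) (X˜≐Y˜ s t) ⟩
    get X ((Y ˜) s t)    ∎

  put≗ : ∀ v t → put X v t ≡ (Y ˜) t (put X v s)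
  put≗ v t = begin
    -- A scene reads only the view of its second argument, so `put X v s` can carry `v` to any
    -- target `t`.
    put X v t              ≡⟨ ˜-put X t s v ⟨
    (X ˜) t (put X v s)    ≡⟨ X˜≐Y˜ t (put X v s) ⟩
    (Y ˜) t (put X v s)    ∎

theorem12 : ∀ {a b c : Level} {S : Set a} {V₁ : Set b} {V₂ : Set c} → S →
    (X : Lens V₁ S) (Y : Lens V₂ S) → (X ≈ Y) ⇔ (X ˜ ≐ₛ Y ˜)
theorem12 s X Y = mk⇔ (≈⇒≐ₛ X Y) λ X˜≐Y˜ →
  ≐ₛ⇒≼ s X Y X˜≐Y˜ , ≐ₛ⇒≼ s Y X (λ s₁ s₂ → sym (X˜≐Y˜ s₁ s₂))
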